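{- For every integer $m\ge 3$ there exists a 3-connected graph $G_m$ having a 2-connected spanning subgraph $H_m$ such that $\gamma_g(G_m)\ge 2m-2$ and $\gamma_g(H_m)=m$.
   Context: Graphs are finite, simple and nonempty. A spanning subgraph of $G$ is a subgraph with the same vertex set as $G$; connectivity is vertex-connectivity. For a vertex $v$, $N[v]$ is its closed neighborhood; a chosen vertex $v$ dominates all vertices of $N[v]$. The domination game on a graph $G$ is played by two players, Dominator and Staller, who alternately choose vertices of $G$; each chosen vertex must dominate at least one vertex that was not dominated by the previously chosen vertices. The game ends when all vertices of $G$ are dominated. Dominator wants the total number of chosen vertices to be as small as possible, Staller wants it to be as large as possible. The game domination number $\gamma_g(G)$ is the total number of vertices chosen (by both players) when Dominator makes the first move and both players play optimally. -}

module Defs where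

open import Data.Fin using (Fin)
open import Data.Fin.Properties using (any?) renaming (_≟_ to _≟ᶠ_)
open import Data.Fin.Subset using (Subset; _∈_; _∉_; _∪_; ∣_∣; ⊥)
open import Data.Fin.Subset.Properties using (_∈?_)
open import Data.List using (List; []; _∷_; map; filter; allFin)
open import Data.List.Extrema.Nat using (min; max)
open import Data.Nat using (ℕ; zero; suc; _<_; NonZero)
open import Data.Product using (_×_; ∃)
open import Data.Vec using (tabulate)
open import Level using (0ℓ)
open import Relation.Binary using (Rel; Symmetric; Irreflexive; Decidable)
open import Relation.Binary.Construct.Closure.ReflexiveTransitive using (Star)
open import Relation.Binary.PropositionalEquality using (_≡_)
open import Relation.Nullary using (does; _×-dec_; _⊎-dec_; ¬?)
import Relation.Unary as U

record Graph (n : ℕ) : Set₁ where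
  field
    nonEmpty : NonZero n
    _~_      : Rel (Fin n) 0ℓ
    _~?_     : Decidable _~_
    ~-sym    : Symmetric _~_
    ~-irrefl : Irreflexive _≡_ _~_

-- Both graphs already share the vertex set Fin n.
_IsSpanningSubgraphOf_ : ∀ {n} → Graph n → Graph n → Set
H IsSpanningSubgraphOf G = ∀ {u v} → Graph._~_ H u v → Graph._~_ G u v

module _ {n : ℕ} (G : Graph n) where
  open Graph G

  -- The graph G − S is connected.  Nonemptiness of G − S is not demanded here;
  -- in `Connected` below it follows from ∣ S ∣ < k < n.
  ConnectedWithout : Subset n → Set
  ConnectedWithout S =
    ∀ {u v} → u ∉ S → v ∉ S → Star (λ x y → x ∉ S × y ∉ S × x ~ y) u v

  -- k-connectivity (vertex-connectivity at least k): more than k vertices, and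
  -- deleting fewer than k of them never disconnects the graph.
  Connected : ℕ → Set
  Connected k = k < n × (∀ S → ∣ S ∣ < k → ConnectedWithout S)

  N[_] : Fin n → Subset n
  N[ v ] = tabulate λ u → does ((u ≟ᶠ v) ⊎-dec (v ~? u))

  -- In a position whose set of dominated vertices is D, the vertex v may be
  -- chosen when it dominates some vertex outside D.
  Legal : Subset n → Fin n → Set
  Legal D v = ∃ λ u → u ∈ N[ v ] × u ∉ D

  legal? : ∀ D → U.Decidable (Legal D)
  legal? D v = any? λ u → (u ∈? N[ v ]) ×-dec ¬? (u ∈? D)

  legalMoves : Subset n → List (Fin n)
  legalMoves D = filter (legal? D) (allFin n)

data Player : Set where
  dominator staller : Player

opponent : Player → Player
opponent dominator = staller
opponent staller   = dominator

-- The number of moves still to be played by a player to move, given the list of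
-- the numbers of moves remaining after each of the legal moves.  The list is
-- empty only when the game is over.
optimum : Player → List ℕ → ℕ
optimum _         []       = 0
optimum dominator (x ∷ xs) = suc (min x xs)
optimum staller   (x ∷ xs) = suc (max x xs)

module _ {n : ℕ} (G : Graph n) where

  -- The minimax value of the position with dominated set D and player p to move.
  -- The game is over exactly when there is no legal move, since an undominated
  -- vertex is itself a legal move.  The first argument bounds the recursion
  -- depth; the value does not depend on it once it is at least the number of
  -- undominated vertices, as every move dominates a new vertex.
  movesLeft : ℕ → Player → Subset n → ℕ
  movesLeft zero       p D = 0
  movesLeft (suc fuel) p D =
    optimum p (map (λ v → movesLeft fuel (opponent p) (D ∪ N[_] G v)) (legalMoves G D))

  γg : ℕ
  γg = movesLeft n dominator ⊥

{-# OPTIONS --safe #-}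
-- Both graphs live on the cells of an m × (m + 3) board and contain all edges
-- inside a row and all edges between the last three columns (the hub).  This is
-- H; the hub meets each row in three cells, so H, and hence G, is 3-connected.
-- G has in addition the edges (i , j) – (j , i) of the square part.
--
-- In H, Dominator opens in the hub, and from then on every move finishes exactly
-- one row.  Conversely, a move in row r of either graph affects only row and
-- column r of the square part; so a square T × T of undominated cells loses at
-- most one index per move, and H takes m moves.  In G, Staller answers a
-- move (r , c) with r ∈ T by (r , j), where j ∈ T and j ≠ c: this dominates
-- (j , r) but spoils no further index of T, so an index is lost only once per
-- two moves.
module Submission where

open import Defs
open import Data.Fin using (Fin; zero; suc)
open import Data.Fin.Properties using (*↔×; +↔⊎; ¬∀⟶∃¬; suc-injective; 0≢1+n)
  renaming (_≟_ to _≟ᶠ_)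
open import Data.Fin.Subset using (Subset; inside; outside; _∈_; _∉_; _⊆_; _∪_; _-_; ∣_∣; ⊥; ⊤; Nonempty)
open import Data.Fin.Subset.Properties
  using (_∈?_; ∉⊥; ∈⊤; ∣⊤∣≡n; p─⊥≡p; p─q⊆p; x∈p∪q⁺; x∈p∪q⁻; x∈p∧x≢y⇒x∈p-y; x∈p⇒∣p-x∣<∣p∣)
open import Data.List using ([]; _∷_; map; allFin)
open import Data.List.Extrema.Nat using (min≤⊤; min≤xs; v≤min⁺; max≤v⁺; v≤max⁺)
open import Data.List.Membership.Propositional using () renaming (_∈_ to _∈ˡ_)
open import Data.List.Membership.Propositional.Properties using (∈-allFin; ∈-filter⁺; ∈-map⁺)
open import Data.List.Relation.Unary.All as All using (All; []; _∷_)
open import Data.List.Relation.Unary.All.Properties using (all-filter; map⁺)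
open import Data.List.Relation.Unary.Any as Any using (here; there)
open import Data.Nat using (ℕ; zero; suc; _+_; _*_; _∸_; _≤_; _<_; _≥_; NonZero; z≤n; s≤s; s≤s⁻¹)
open import Data.Nat.Properties
  using (≤-refl; ≤-reflexive; ≤-trans; ≤-antisym; <-≤-trans; <⇒≱; <⇒≤; n≤1+n; m≤n⇒m≤1+n; m≤n+m; _<?_; ≮⇒≥; n<1⇒n≡0;
         m≤n⇒m≤n+o; m≤m*n; *-comm; *-mono-≤)
open import Data.Product using (_×_; ∃; ∃₂; _,_; proj₁; proj₂)
open import Data.Product.Function.NonDependent.Propositional using (_×-↔_)
open import Data.Product.Properties using (,-injectiveʳ)
open import Data.Sum using (_⊎_; inj₁; inj₂; [_,_]′)
open import Data.Sum.Properties using (inj₂-injective)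
open import Data.Vec using ([]; _∷_; here; there)
open import Data.Vec.Properties using (lookup∘tabulate; lookup⇒[]=; []=⇒lookup)
open import Function using (_∘_; id; _↔_; Inverse)
open import Function.Construct.Composition using (_↔-∘_)
open import Function.Construct.Identity using (↔-id)
open import Level using (0ℓ)
open import Relation.Binary using (Rel; Symmetric; Reflexive; Decidable; _⇒_)
open import Relation.Binary.Construct.Closure.ReflexiveTransitive as Star using (Star; ε; _◅_; _◅◅_)
open import Relation.Binary.PropositionalEquality using (_≡_; _≢_; refl; sym; trans; cong; subst; subst₂)
open import Relation.Nullary using (¬_; yes; no; Reflects; invert; proof; ¬?; _×-dec_; _⊎-dec_; contradiction)
open import Relation.Nullary.Decidable using (dec-true; map′)

-- Cardinality of subsets and pigeonhole

x∉p-x : ∀ {n} (p : Subset n) x → x ∉ p - x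
x∉p-x (_ ∷ p) (suc x) (there x∈) = x∉p-x p x x∈

∣p∣≤1+∣p-x∣ : ∀ {n} (p : Subset n) x → ∣ p ∣ ≤ suc ∣ p - x ∣
∣p∣≤1+∣p-x∣ (inside  ∷ p) zero    = s≤s (≤-reflexive (cong ∣_∣ (sym (p─⊥≡p p))))
∣p∣≤1+∣p-x∣ (outside ∷ p) zero    = m≤n⇒m≤1+n (≤-reflexive (cong ∣_∣ (sym (p─⊥≡p p))))
∣p∣≤1+∣p-x∣ (inside  ∷ p) (suc x) = s≤s (∣p∣≤1+∣p-x∣ p x)
∣p∣≤1+∣p-x∣ (outside ∷ p) (suc x) = ∣p∣≤1+∣p-x∣ p x

0<∣p∣⇒nonempty : ∀ {n} (p : Subset n) → 0 < ∣ p ∣ → Nonempty p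
0<∣p∣⇒nonempty (inside  ∷ p) _   = zero , here
0<∣p∣⇒nonempty (outside ∷ p) 0<p = let x , x∈p = 0<∣p∣⇒nonempty p 0<p in suc x , there x∈p

injective⇒≤∣p∣ : ∀ {n} k (f : Fin k → Fin n) (p : Subset n) →
                 (∀ {i j} → f i ≡ f j → i ≡ j) → (∀ i → f i ∈ p) → k ≤ ∣ p ∣
injective⇒≤∣p∣ zero    f p f-inj f∈p = z≤n
injective⇒≤∣p∣ (suc k) f p f-inj f∈p =
  <-≤-trans (s≤s (injective⇒≤∣p∣ k (f ∘ suc) (p - f zero) (suc-injective ∘ f-inj)
                    λ i → x∈p∧x≢y⇒x∈p-y (f∈p (suc i)) (0≢1+n ∘ sym ∘ f-inj)))
            (x∈p⇒∣p-x∣<∣p∣ (f∈p zero))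

-- Pigeonhole; it supplies a hub cell that survives the deletion of a small vertex set.
injective⇒∃∉ : ∀ {n} k (f : Fin k → Fin n) (p : Subset n) →
               (∀ {i j} → f i ≡ f j → i ≡ j) → ∣ p ∣ < k → ∃ λ i → f i ∉ p
injective⇒∃∉ k f p f-inj p<k =
  ¬∀⟶∃¬ k (λ i → f i ∈ p) (λ i → f i ∈? p) λ f∈p → <⇒≱ p<k (injective⇒≤∣p∣ k f p f-inj f∈p)

-- Bounds on minimax values

optimum≤ : ∀ p xs {b} → All (_< b) xs → optimum p xs ≤ b
optimum≤ p         []       []             = z≤n
optimum≤ dominator (x ∷ xs) (x<b ∷ _)      = ≤-trans (s≤s (min≤⊤ x xs)) x<b
optimum≤ staller   (x ∷ xs) (s≤s x≤b ∷ xs<b) = s≤s (max≤v⁺ x≤b (All.map s≤s⁻¹ xs<b))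

-- The member `y` excludes the empty list, where `optimum` takes the value 0.
≤optimum : ∀ p xs {b y} → y ∈ˡ xs → All (λ x → b ≤ suc x) xs → b ≤ optimum p xs
≤optimum p         xs       {zero}  _ _ = z≤n
≤optimum dominator (x ∷ xs) {suc b} _ (s≤s b≤x ∷ b≤xs) = s≤s (v≤min⁺ b≤x (All.map s≤s⁻¹ b≤xs))
≤optimum staller   (x ∷ xs) {suc b} _ (s≤s b≤x ∷ _)    = s≤s (v≤max⁺ x xs (inj₁ b≤x))

optimum-dominator≤ : ∀ {xs x} → x ∈ˡ xs → optimum dominator xs ≤ suc x
optimum-dominator≤ {x ∷ xs} (here refl) = s≤s (min≤⊤ x xs)
optimum-dominator≤ {x ∷ xs} (there y∈)  = s≤s (All.lookup (min≤xs x xs) y∈)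

≤optimum-staller : ∀ {xs x} → x ∈ˡ xs → suc x ≤ optimum staller xs
≤optimum-staller {x ∷ xs} (here refl) = s≤s (v≤max⁺ x xs (inj₁ ≤-refl))
≤optimum-staller {x ∷ xs} (there y∈)  = s≤s (v≤max⁺ x xs (inj₂ (Any.map ≤-reflexive y∈)))

-- Neighborhoods and game values in an arbitrary graph

module _ {n} (G : Graph n) where
  open Graph G

  ∈N[]⁺ : ∀ {u v} → u ≡ v ⊎ v ~ u → u ∈ N[_] G v
  ∈N[]⁺ {u} {v} adj = lookup⇒[]= u _
    (trans (lookup∘tabulate _ u) (dec-true ((u ≟ᶠ v) ⊎-dec (v ~? u)) adj))

  ∈N[]⁻ : ∀ {u v} → u ∈ N[_] G v → u ≡ v ⊎ v ~ u
  ∈N[]⁻ {u} {v} u∈ = invert (subst (Reflects _)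
    (trans (sym (lookup∘tabulate _ u)) ([]=⇒lookup u∈)) (proof ((u ≟ᶠ v) ⊎-dec (v ~? u))))

  ∈legalMoves : ∀ {D v} → Legal G D v → v ∈ˡ legalMoves G D
  ∈legalMoves {D} {v} = ∈-filter⁺ (legal? G D) (∈-allFin v)

  allLegal : ∀ {D} {P : ℕ → Set} {f : Fin n → ℕ} → (∀ v → Legal G D v → P (f v)) →
             All P (map f (legalMoves G D))
  allLegal {D} h = map⁺ (All.map (h _) (all-filter (legal? G D) (allFin n)))

  -- This bound and the next range over all legal moves, so they hold whoever is to move.
  movesLeft≤ : ∀ f p {D b} →
    (∀ v → Legal G D v → movesLeft G f (opponent p) (D ∪ N[_] G v) < b) →
    movesLeft G (suc f) p D ≤ b
  movesLeft≤ f p h = optimum≤ p _ (allLegal h)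

  ≤movesLeft : ∀ f p {D b} → ∃ (Legal G D) →
    (∀ v → Legal G D v → b ≤ suc (movesLeft G f (opponent p) (D ∪ N[_] G v))) →
    b ≤ movesLeft G (suc f) p D
  ≤movesLeft f p (_ , w-legal) h = ≤optimum p _ (∈-map⁺ _ (∈legalMoves w-legal)) (allLegal h)

  -- This bound and `≤movesLeft-staller` are for strategies: the player to move commits to one move
  -- `v`.
  movesLeft-dominator≤ : ∀ f {D} v → Legal G D v →
    movesLeft G (suc f) dominator D ≤ suc (movesLeft G f staller (D ∪ N[_] G v))
  movesLeft-dominator≤ f v v-legal = optimum-dominator≤ (∈-map⁺ _ (∈legalMoves v-legal))

  ≤movesLeft-staller : ∀ f {D} v → Legal G D v →
    suc (movesLeft G f dominator (D ∪ N[_] G v)) ≤ movesLeft G (suc f) staller D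
  ≤movesLeft-staller f v v-legal = ≤optimum-staller (∈-map⁺ _ (∈legalMoves v-legal))

-- Monotonicity of connectivity

connected-⊆ : ∀ {n k} (H G : Graph n) → H IsSpanningSubgraphOf G → Connected H k → Connected G k
connected-⊆ H G H⊆G (k<n , conn) = k<n , λ S S<k u∉S v∉S →
  Star.map (λ (x∉S , y∉S , x~y) → x∉S , y∉S , H⊆G x~y) (conn S S<k u∉S v∉S)

connected-≤ : ∀ {n k l} (G : Graph n) → k ≤ l → Connected G l → Connected G k
connected-≤ G k≤l (l<n , conn) = ≤-trans (s≤s k≤l) l<n , λ S S<k → conn S (<-≤-trans S<k k≤l)

-- The board graphs

Cell : ℕ → Set
Cell m = Fin m × (Fin m ⊎ Fin 3)

cells : ∀ m → Fin (m * (m + 3)) ↔ Cell m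
cells m = (↔-id (Fin m) ×-↔ +↔⊎) ↔-∘ *↔×

-- The bijection is a parameter, so that the arguments see only cells and never the arithmetic of
-- their numbering.
module Board (m n : ℕ) {{n≢0 : NonZero n}} (numbering : Fin n ↔ Cell m) where

  open Inverse numbering using (to; from) renaming (strictlyInverseˡ to to∘from)

  from-injective : ∀ {x y : Cell m} → from x ≡ from y → x ≡ y
  from-injective eq = trans (sym (to∘from _)) (trans (cong to eq) (to∘from _))

  -- Closed adjacency: reflexive, so that N[ v ] consists of the u with v ≈ u.
  infix 4 _≈ᴴ_ _≈ᴳ_

  data _≈ᴴ_ : Rel (Cell m) 0ℓ where
    row : ∀ {i c d}   → (i , c)      ≈ᴴ (i , d)
    hub : ∀ {i k a b} → (i , inj₂ a) ≈ᴴ (k , inj₂ b)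

  data _≈ᴳ_ : Rel (Cell m) 0ℓ where
    incl   : _≈ᴴ_ ⇒ _≈ᴳ_
    mirror : ∀ {i j} → (i , inj₁ j) ≈ᴳ (j , inj₁ i)

  ≈ᴴ-sym : Symmetric _≈ᴴ_
  ≈ᴴ-sym row = row
  ≈ᴴ-sym hub = hub

  ≈ᴳ-sym : Symmetric _≈ᴳ_
  ≈ᴳ-sym (incl e) = incl (≈ᴴ-sym e)
  ≈ᴳ-sym mirror   = mirror

  _≈ᴴ?_ : Decidable _≈ᴴ_
  (i , inj₂ a) ≈ᴴ? (k , inj₂ b) = yes hub
  (i , inj₁ a) ≈ᴴ? (k , d)      = map′ (λ { refl → row }) (λ { row → refl }) (i ≟ᶠ k)
  (i , inj₂ a) ≈ᴴ? (k , inj₁ b) = map′ (λ { refl → row }) (λ { row → refl }) (i ≟ᶠ k)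

  _≈ᴳ?_ : Decidable _≈ᴳ_
  x@(i , inj₁ j) ≈ᴳ? y@(k , inj₁ l) =
    map′ [ incl , (λ { (refl , refl) → mirror }) ]′
         (λ { (incl e) → inj₁ e ; mirror → inj₂ (refl , refl) })
         ((x ≈ᴴ? y) ⊎-dec ((i ≟ᶠ l) ×-dec (j ≟ᶠ k)))
  x@(_ , inj₁ _) ≈ᴳ? y@(_ , inj₂ _) = map′ incl (λ { (incl e) → e }) (x ≈ᴴ? y)
  x@(_ , inj₂ _) ≈ᴳ? y              = map′ incl (λ { (incl e) → e }) (x ≈ᴴ? y)

  -- Hub edges never end in the square part, and the mirror of a cell in row r lies in column r.
  ≈ᴳ-square⁻ : ∀ {x i j} → x ≈ᴳ (i , inj₁ j) → proj₁ x ≡ i ⊎ proj₁ x ≡ j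
  ≈ᴳ-square⁻ (incl row) = inj₁ refl
  ≈ᴳ-square⁻ mirror     = inj₂ refl

  cellGraph : {_≈_ : Rel (Cell m) 0ℓ} → Decidable _≈_ → Symmetric _≈_ → Graph n
  cellGraph {_≈_} _≈?_ ≈-sym = record
    { nonEmpty = n≢0
    ; _~_      = λ u v → u ≢ v × to u ≈ to v
    ; _~?_     = λ u v → ¬? (u ≟ᶠ v) ×-dec (to u ≈? to v)
    ; ~-sym    = λ (u≢v , u≈v) → u≢v ∘ sym , ≈-sym u≈v
    ; ~-irrefl = λ u≡v (u≢v , _) → u≢v u≡v
    }

  H G : Graph n
  H = cellGraph _≈ᴴ?_ ≈ᴴ-sym
  G = cellGraph _≈ᴳ?_ ≈ᴳ-sym

  H⊆G : H IsSpanningSubgraphOf G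
  H⊆G (u≢v , u≈v) = u≢v , incl u≈v

  -- Undominated squares and the common lower bound

  Undominated : Subset n → Subset m → Set
  Undominated D T = ∀ {i j} → i ∈ T → j ∈ T → from (i , inj₁ j) ∉ D

  undominated-⊥ : ∀ {T} → Undominated ⊥ T
  undominated-⊥ _ _ = ∉⊥

  -- Any closed relation inside `_≈ᴳ_` is allowed, so that the same facts serve `H` and `G`.
  module _ {_≈_ : Rel (Cell m) 0ℓ} (_≈?_ : Decidable _≈_) (≈-sym : Symmetric _≈_)
           (≈-refl : Reflexive _≈_) (≈⇒≈ᴳ : _≈_ ⇒ _≈ᴳ_) where

    private Γ = cellGraph _≈?_ ≈-sym

    ∈N⁺ : ∀ u v → to v ≈ to u → u ∈ N[_] Γ v
    ∈N⁺ u v v≈u with u ≟ᶠ v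
    ... | yes u≡v = ∈N[]⁺ Γ (inj₁ u≡v)
    ... | no  u≢v = ∈N[]⁺ Γ (inj₂ (u≢v ∘ sym , v≈u))

    ∈N⁻ : ∀ u v → u ∈ N[_] Γ v → to v ≈ to u
    ∈N⁻ u v u∈N with ∈N[]⁻ Γ {u} {v} u∈N
    ... | inj₁ refl      = ≈-refl
    ... | inj₂ (_ , v≈u) = v≈u

    undominated⇒legal : ∀ {D} v → v ∉ D → Legal Γ D v
    undominated⇒legal v v∉D = v , ∈N⁺ v v ≈-refl , v∉D

    -- `T′` is kept general because a move in a row outside `T` costs no index at all; this is what
    -- makes Staller's reply in the row just played free.
    undominated-step : ∀ {D T T′} v → Undominated D T → T′ ⊆ T → proj₁ (to v) ∉ T′ →
                       Undominated (D ∪ N[_] Γ v) T′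
    undominated-step {D} v und T′⊆T r∉T′ i∈T′ j∈T′ x∈ with x∈p∪q⁻ D _ x∈
    ... | inj₁ x∈D = und (T′⊆T i∈T′) (T′⊆T j∈T′) x∈D
    ... | inj₂ x∈N with ≈ᴳ-square⁻ (≈⇒≈ᴳ (subst (to v ≈_) (to∘from _) (∈N⁻ _ v x∈N)))
    ...   | inj₁ r≡i = r∉T′ (subst (_∈ _) (sym r≡i) i∈T′)
    ...   | inj₂ r≡j = r∉T′ (subst (_∈ _) (sym r≡j) j∈T′)

    undominated-row : ∀ {D T} v → Undominated D T → Undominated (D ∪ N[_] Γ v) (T - proj₁ (to v))
    undominated-row {T = T} v und = undominated-step v und (p─q⊆p T _) (x∉p-x T _)

    undominated⇒∃legal : ∀ {D T} → Undominated D T → 0 < ∣ T ∣ → ∃ (Legal Γ D)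
    undominated⇒∃legal {T = T} und 0<T =
      let i , i∈T = 0<∣p∣⇒nonempty T 0<T in _ , undominated⇒legal _ (und i∈T i∈T)

    -- Each move, by either player, costs at most one index, and while an index i is left the cell
    -- (i , i) keeps the game going.
    undominated⇒≤movesLeft : ∀ k f p {D T} → Undominated D T → k ≤ ∣ T ∣ → k ≤ f →
                             k ≤ movesLeft Γ f p D
    undominated⇒≤movesLeft zero    f       p und k≤T k≤f = z≤n
    undominated⇒≤movesLeft (suc k) (suc f) p {T = T} und k<T (s≤s k≤f) =
      ≤movesLeft Γ f p (undominated⇒∃legal und (≤-trans (s≤s z≤n) k<T)) λ v _ →
        s≤s (undominated⇒≤movesLeft k f (opponent p) (undominated-row v und)
               (s≤s⁻¹ (≤-trans k<T (∣p∣≤1+∣p-x∣ T _))) k≤f)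

    -- The closed relation also holds at equal vertices, where the graph has no edge and the path is
    -- empty.
    singleStep : ∀ {S} u v → u ∉ S → v ∉ S → to u ≈ to v →
                 Star (λ x y → x ∉ S × y ∉ S × Graph._~_ Γ x y) u v
    singleStep u v u∉S v∉S u≈v with u ≟ᶠ v
    ... | yes refl = ε
    ... | no  u≢v  = (u∉S , v∉S , u≢v , u≈v) ◅ ε

  ≈ᴴ-refl : Reflexive _≈ᴴ_
  ≈ᴴ-refl = row

  ≈ᴳ-refl : Reflexive _≈ᴳ_
  ≈ᴳ-refl = incl row

  ∈Nᴴ⁺ : ∀ u v → to v ≈ᴴ to u → u ∈ N[_] H v
  ∈Nᴴ⁺ = ∈N⁺ _≈ᴴ?_ ≈ᴴ-sym ≈ᴴ-refl incl

  -- 3-connectivity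

  survivingHub : ∀ S → ∣ S ∣ < 3 → ∀ i → ∃ λ a → from (i , inj₂ a) ∉ S
  survivingHub S S<3 i = injective⇒∃∉ 3 (λ a → from (i , inj₂ a)) S
    (λ eq → inj₂-injective (,-injectiveʳ (from-injective eq))) S<3

  H-3-connected : 3 < n → Connected H 3
  H-3-connected 3<n = 3<n , λ S S<3 {u} {v} u∉S v∉S →
    let i = proj₁ (to u)
        k = proj₁ (to v)
        a , a∉S = survivingHub S S<3 i
        b , b∉S = survivingHub S S<3 k
        step = singleStep _≈ᴴ?_ ≈ᴴ-sym ≈ᴴ-refl incl
        ia≡ = sym (to∘from (i , inj₂ a))
        kb≡ = sym (to∘from (k , inj₂ b))
    -- The route goes along the row of `u` to a surviving hub cell, across the hub, and along the
    -- row of `v`.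
    in step _ _ u∉S a∉S (subst (to u ≈ᴴ_) ia≡ row)
       ◅◅ step _ _ a∉S b∉S (subst₂ _≈ᴴ_ ia≡ kb≡ hub)
       ◅◅ step _ _ b∉S v∉S (subst (_≈ᴴ to v) kb≡ row)

  -- Upper bound for `H`

  UndominatedWithin : Subset n → Subset m → Set
  UndominatedWithin D T = ∀ {u} → u ∉ D → ∃₂ λ i j → i ∈ T × to u ≡ (i , inj₁ j)

  -- In `H` a square cell is reached only along its row, so `v` lies in row `i` and dominates all of
  -- it.
  within-step : ∀ {D T i j} v → to v ≈ᴴ (i , inj₁ j) → UndominatedWithin D T →
                UndominatedWithin (D ∪ N[_] H v) (T - i)
  within-step {i = i} v v≈ within {u} u∉ with within (u∉ ∘ x∈p∪q⁺ ∘ inj₁)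
  ... | i′ , j′ , i′∈T , u≡ = i′ , j′ , x∈p∧x≢y⇒x∈p-y i′∈T i′≢i , u≡
    where
    sameRow : ∀ {x y i i′ j j′} → x ≈ᴴ (i , inj₁ j) → y ≡ (i′ , inj₁ j′) → i′ ≡ i → x ≈ᴴ y
    sameRow row refl refl = row
    i′≢i : i′ ≢ i
    i′≢i i′≡i = u∉ (x∈p∪q⁺ (inj₂ (∈Nᴴ⁺ u v (sameRow v≈ u≡ i′≡i))))

  movesLeft-H≤ : ∀ f p {D T} → UndominatedWithin D T → movesLeft H f p D ≤ ∣ T ∣
  movesLeft-H≤ zero    p _ = z≤n
  movesLeft-H≤ (suc f) p within = movesLeft≤ H f p λ v (u , u∈N , u∉D) →
    let i , j , i∈T , u≡ = within u∉D
        v≈u = subst (to v ≈ᴴ_) u≡ (∈N⁻ _≈ᴴ?_ ≈ᴴ-sym ≈ᴴ-refl incl u v u∈N)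
    in <-≤-trans (s≤s (movesLeft-H≤ f (opponent p) (within-step v v≈u within))) (x∈p⇒∣p-x∣<∣p∣ i∈T)

  movesLeft-H≤m : Fin m → ∀ f → movesLeft H f dominator ⊥ ≤ m
  movesLeft-H≤m i₀ zero    = z≤n
  movesLeft-H≤m i₀ (suc f) =
    ≤-trans (movesLeft-dominator≤ H f v₀ (undominated⇒legal _≈ᴴ?_ ≈ᴴ-sym ≈ᴴ-refl incl v₀ ∉⊥))
      (≤-trans (s≤s (movesLeft-H≤ f staller within))
        (<-≤-trans (x∈p⇒∣p-x∣<∣p∣ {p = ⊤ {m}} ∈⊤) (≤-reflexive (∣⊤∣≡n m))))
    where
    -- A hub cell dominates the whole hub and its own row, leaving only square cells of the other
    -- rows.
    v₀ = from (i₀ , inj₂ zero)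
    ∈D : ∀ {u x} → to u ≡ x → (i₀ , inj₂ zero) ≈ᴴ x → u ∈ ⊥ ∪ N[_] H v₀
    ∈D {u} u≡ e = x∈p∪q⁺ (inj₂ (∈Nᴴ⁺ u v₀ (subst₂ _≈ᴴ_ (sym (to∘from _)) (sym u≡) e)))
    within : UndominatedWithin (⊥ ∪ N[_] H v₀) (⊤ - i₀)
    within {u} u∉ with to u in u≡
    ... | i , inj₁ j = i , j , x∈p∧x≢y⇒x∈p-y ∈⊤ (λ { refl → u∉ (∈D u≡ row) }) , refl
    ... | i , inj₂ a = contradiction (∈D u≡ hub) u∉

  m≤movesLeft-H : ∀ f → m ≤ f → m ≤ movesLeft H f dominator ⊥
  m≤movesLeft-H f = undominated⇒≤movesLeft _≈ᴴ?_ ≈ᴴ-sym ≈ᴴ-refl incl m f dominator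
    (undominated-⊥ {⊤}) (≤-reflexive (sym (∣⊤∣≡n m)))

  -- Staller's strategy in `G`

  otherColumn : ∀ (T : Subset m) (c : Fin m ⊎ Fin 3) → 1 < ∣ T ∣ → ∃ λ j → j ∈ T × c ≢ inj₁ j
  otherColumn T (inj₂ a) 1<T = let j , j∈T = 0<∣p∣⇒nonempty T (<⇒≤ 1<T) in j , j∈T , λ ()
  otherColumn T (inj₁ c) 1<T with 0<∣p∣⇒nonempty (T - c) (s≤s⁻¹ (≤-trans 1<T (∣p∣≤1+∣p-x∣ T c)))
  ... | j , j∈ = j , p─q⊆p T _ j∈ , λ { refl → x∉p-x T j j∈ }

  -- In column r of the square, a move (r , c) dominates only (r , r) and, if c is a square column,
  -- the mirror cell (c , r).
  mirror-∉N : ∀ {j} v → j ≢ proj₁ (to v) → proj₂ (to v) ≢ inj₁ j →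
              from (j , inj₁ (proj₁ (to v))) ∉ N[_] G v
  mirror-∉N v j≢r c≢j x∈N = excluded j≢r c≢j
    (subst (to v ≈ᴳ_) (to∘from _) (∈N⁻ _≈ᴳ?_ ≈ᴳ-sym ≈ᴳ-refl id _ v x∈N))
    where
    excluded : ∀ {r c j} → j ≢ r → c ≢ inj₁ j → ¬ (r , c) ≈ᴳ (j , inj₁ r)
    excluded j≢r c≢j (incl row) = j≢r refl
    excluded j≢r c≢j mirror     = c≢j refl

  -- A Dominator move and its reply together cost one index. The strict bound on `k` holds one index
  -- in reserve, for the endgame where a mirror reply may be missing.
  ≤movesLeft-G : ∀ k f {D T} → Undominated D T → k < ∣ T ∣ → k * 2 ≤ f →
                 k * 2 ≤ movesLeft G f dominator D
  ≤movesLeft-G zero    f _ _ _ = z≤n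
  ≤movesLeft-G (suc k) (suc (suc f)) {D} {T} und k<T (s≤s (s≤s k≤f)) =
    ≤movesLeft G (suc f) dominator
      (undominated⇒∃legal _≈ᴳ?_ ≈ᴳ-sym ≈ᴳ-refl id und (≤-trans (s≤s z≤n) k<T))
      λ v _ → s≤s (reply v)
    where
    legal-at : ∀ {D} v → v ∉ D → Legal G D v
    legal-at = undominated⇒legal _≈ᴳ?_ ≈ᴳ-sym ≈ᴳ-refl id

    und-step : ∀ {D T T′} v → Undominated D T → T′ ⊆ T → proj₁ (to v) ∉ T′ →
               Undominated (D ∪ N[_] G v) T′
    und-step = undominated-step _≈ᴳ?_ ≈ᴳ-sym ≈ᴳ-refl id

    und-row : ∀ {D T} v → Undominated D T → Undominated (D ∪ N[_] G v) (T - proj₁ (to v))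
    und-row = undominated-row _≈ᴳ?_ ≈ᴳ-sym ≈ᴳ-refl id

    reply-with : ∀ {D′ T′} w → Legal G D′ w → Undominated (D′ ∪ N[_] G w) T′ → k < ∣ T′ ∣ →
                 suc (k * 2) ≤ movesLeft G (suc f) staller D′
    reply-with w w-legal und′ k<T′ =
      ≤-trans (s≤s (≤movesLeft-G k f und′ k<T′ k≤f)) (≤movesLeft-staller G f w w-legal)

    k<T-x : ∀ x → k < ∣ T - x ∣
    k<T-x x = s≤s⁻¹ (≤-trans k<T (∣p∣≤1+∣p-x∣ T x))

    reply : ∀ v → suc (k * 2) ≤ movesLeft G (suc f) staller (D ∪ N[_] G v)
    reply v with proj₁ (to v) ∈? T
    -- Dominator's move cost nothing here, so Staller can afford to lose the index `j`.
    ... | no r∉T =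
      let j , j∈T = 0<∣p∣⇒nonempty T (≤-trans (s≤s z≤n) k<T)
          und′ = und-step v und id r∉T
          w = from (j , inj₁ j)
      in reply-with w (legal-at w (und′ j∈T j∈T)) (und-row w und′) (k<T-x _)
    ... | yes r∈T with 1 <? ∣ T - proj₁ (to v) ∣
    -- The only index left may be the column of `v`, which rules out the mirror reply. But then `k`
    -- is 0, and the one further move claimed exists because an undominated cell remains.
    ...   | no T-r≯1 = subst (λ k → suc (k * 2) ≤ movesLeft G (suc f) staller (D ∪ N[_] G v))
      (sym (n<1⇒n≡0 (<-≤-trans (k<T-x _) (≮⇒≥ T-r≯1))))
      (undominated⇒≤movesLeft _≈ᴳ?_ ≈ᴳ-sym ≈ᴳ-refl id 1 (suc f) staller
        (und-row v und) (≤-trans (s≤s z≤n) (k<T-x _)) (s≤s z≤n))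
    ...   | yes T-r>1 =
      let r , c = to v
          j , j∈T-r , c≢j = otherColumn (T - r) c T-r>1
          -- The reply stays in row `r`, whose index is already lost; it is legal because it newly
          -- dominates the mirror cell `u`.
          w = from (r , inj₁ j)
          u = from (j , inj₁ r)
          u∈Nw = ∈N⁺ _≈ᴳ?_ ≈ᴳ-sym ≈ᴳ-refl id u w
            (subst₂ _≈ᴳ_ (sym (to∘from _)) (sym (to∘from _)) mirror)
          u∉D = und (p─q⊆p T _ j∈T-r) r∈T
          u∉Nv = mirror-∉N v (λ j≡r → x∉p-x T r (subst (_∈ T - r) j≡r j∈T-r)) c≢j
          r∉T-r = subst (λ x → proj₁ x ∉ T - r) (sym (to∘from (r , inj₁ j))) (x∉p-x T r)
      in reply-with w (u , u∈Nw , [ u∉D , u∉Nv ]′ ∘ x∈p∪q⁻ D _)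
           (und-step w (und-row v und) id r∉T-r) (k<T-x r)

theorem4p2 : ∀ (m : ℕ) → m ≥ 3 →
    ∃ λ (n : ℕ) → ∃ λ (G : Graph n) → ∃ λ (H : Graph n) →
    Connected G 3 × H IsSpanningSubgraphOf G × Connected H 2 ×
    γg G ≥ 2 * m ∸ 2 × γg H ≡ m
theorem4p2 m@(suc ℓ) _ =
  n , G , H , connected-⊆ H G H⊆G H-conn , H⊆G , connected-≤ H (n≤1+n 2) H-conn , γg-G≥ ,
  ≤-antisym (movesLeft-H≤m zero n) (m≤movesLeft-H n (m≤m*n m (m + 3)))
  where
  n = m * (m + 3)
  open Board m n (cells m)
  H-conn : Connected H 3
  H-conn = H-3-connected (s≤s (m≤n⇒m≤n+o _ (m≤n+m 3 ℓ)))
  γg-G≥ : γg G ≥ 2 * m ∸ 2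
  γg-G≥ = subst (_≤ γg G) (cong (_∸ 2) (*-comm m 2))
    -- The full square has `m` = `suc ℓ` indices, hence `ℓ` pairs of moves, and `m * 2 ∸ 2` computes
    -- to `ℓ * 2`.
    (≤movesLeft-G ℓ n (undominated-⊥ {⊤}) (≤-reflexive (sym (∣⊤∣≡n m)))
      (*-mono-≤ (n≤1+n ℓ) (s≤s (≤-trans (s≤s z≤n) (m≤n+m 3 ℓ)))))
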